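{- Any dividing rank with Extension (on any class of complete types) is a forking rank.
   Context: $T$ is a complete first-order theory with a monster model $\mathfrak C$ (sufficiently saturated and strongly homogeneous); all parameter sets are small subsets of $\mathfrak C$. Complete types are finitary. A class of complete types is a class $\mathfrak A$ of complete types closed under complete extensions and under conjugation by automorphisms of $\mathfrak C$. A rank on $\mathfrak A$ is a mapping $R:\mathfrak A\to\mathrm{Ord}\cup\{\infty\}$ with Heredity ($p\subseteq q$ implies $R(p)\ge R(q)$) and Isomorphism ($R(p)=R(p^f)$ for $f\in Aut(\mathfrak C)$); $p$ is ranked by $R$ if $R(p)<\infty$. A rank $R$ on $\mathfrak A$ is a dividing (resp. forking) rank if for all $p\in S(A)$, $q\in S(B)$ in $\mathfrak A$ with $p\subseteq q$, $p$ ranked, and $q$ dividing (resp. forking) over $A$, one has $R(p)>R(q)$. $R$ has Extension if for every ranked $p(x)\in S(A)$ in $\mathfrak A$ and every $B\supseteq A$, there is an extension $q(x)\in S(B)$ of $p$ with $R(p)=R(q)$. -}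

module Defs where

open import Data.Fin.Base using (Fin)
open import Data.List.Base using (List)
open import Data.List.Relation.Unary.All using () renaming (All to Allᴸ)
open import Data.List.Relation.Unary.Any using () renaming (Any to Anyᴸ)
open import Data.Nat.Base using (ℕ; suc; _+_)
open import Data.Product using (Σ-syntax; ∃; ∃-syntax; _×_; proj₁; proj₂)
open import Data.Sum.Base using (_⊎_)
open import Data.Vec.Base using (Vec; []; _∷_; _++_; lookup; map)
open import Data.Vec.Relation.Unary.All using (All)
open import Data.Empty.Polymorphic using (⊥)
open import Function.Bundles using (_⇔_; _↔_; Inverse)
open import Function.Definitions using (Injective)
open import Induction.WellFounded using (WellFounded)
open import Level using (Level; _⊔_) renaming (suc to lsuc)
open import Relation.Binary.Core using (Rel)
open import Relation.Binary.Morphism.Structures using (IsOrderIsomorphism)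
open import Relation.Binary.PropositionalEquality using (_≡_)
open import Relation.Binary.Structures using (IsStrictTotalOrder)
open import Relation.Nullary.Construct.Add.Supremum using (_⁺; ⊤⁺)
open import Relation.Nullary.Negation using (¬_)
open import Relation.Unary using (Pred; _∈_; _⊆_; _≐_; U)
import Relation.Binary.Construct.Add.Supremum.Equality as Equality⁺
import Relation.Binary.Construct.Add.Supremum.NonStrict as NonStrict⁺
import Relation.Binary.Construct.Add.Supremum.Strict as Strict⁺

------------------------------------------------------------------------
-- Ordinals and cardinals

-- Ordinals are represented by well-ordered sets and compared up to order
-- isomorphism.
record Ord (o : Level) : Set (lsuc o) where
  infix 4 _<_
  field
    Carrier            : Set o
    _<_                : Rel Carrier o
    isStrictTotalOrder : IsStrictTotalOrder _≡_ _<_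
    wellFounded        : WellFounded _<_

module _ {o : Level} where

  infix 4 _≈ᵒ_ _≤ᵒ_ _<ᵒ_ _≈∞_ _≤∞_ _<∞_

  _≈ᵒ_ : Rel (Ord o) o
  α ≈ᵒ β = ∃ (IsOrderIsomorphism _≡_ _≡_ α._<_ β._<_)
    where module α = Ord α
          module β = Ord β

  -- α embeds onto an initial segment of β.
  _≤ᵒ_ : Rel (Ord o) o
  α ≤ᵒ β = Σ[ f ∈ (α.Carrier → β.Carrier) ]
             (∀ {x y} → x α.< y → f x β.< f y)
           × (∀ {x y} → y β.< f x → ∃[ x′ ] f x′ ≡ y)
    where module α = Ord α
          module β = Ord β

  -- α is isomorphic to the proper initial segment { y | y < b } of β.
  _<ᵒ_ : Rel (Ord o) o
  α <ᵒ β = ∃[ b ] Σ[ f ∈ (α.Carrier → β.Carrier) ]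
             (∀ {x y} → x α.< y → f x β.< f y)
           × (∀ y → (y β.< b) ⇔ (∃[ x ] f x ≡ y))
    where module α = Ord α
          module β = Ord β

  -- Ord ∪ {∞}, with ∞ = ⊤⁺.
  Ord∞ : Set (lsuc o)
  Ord∞ = Ord o ⁺

  _≈∞_ : Rel Ord∞ (lsuc o)
  _≈∞_ = Equality⁺._≈⁺_ _≈ᵒ_

  _≤∞_ : Rel Ord∞ (lsuc o)
  _≤∞_ = NonStrict⁺._≤⁺_ _≤ᵒ_

  _<∞_ : Rel Ord∞ (lsuc o)
  _<∞_ = Strict⁺._<⁺_ _<ᵒ_

-- |A| < κ for an infinite cardinal κ and a subset A of an inhabited set X:
-- A is covered by a κ-sequence restricted to some { j | j < k }.
HasCardinality<_ : ∀ {ℓ} (κ : Ord ℓ) {X : Set ℓ} {a : Level} → Pred X a → Set (ℓ ⊔ a)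
HasCardinality<_ κ {X} A =
  ∃[ k ] Σ[ f ∈ (Carrier → X) ] (∀ {x} → x ∈ A → ∃[ j ] (j < k) × (f j ≡ x))
  where open Ord κ

-- An infinite cardinal is an initial ordinal that is nonzero and has no last
-- element.
record IsInfiniteCardinal {ℓ} (κ : Ord ℓ) : Set ℓ where
  open Ord κ
  field
    nonzero : Carrier
    noLast  : ∀ k → ∃[ k′ ] k < k′
    initial : ¬ (HasCardinality< κ) {Carrier} U

------------------------------------------------------------------------
-- First-order logic

record Language (ℓ : Level) : Set (lsuc ℓ) where
  field
    Func   : Set ℓ
    arityᶠ : Func → ℕ
    Rela   : Set ℓ
    arityʳ : Rela → ℕ

module _ {ℓ : Level} (L : Language ℓ) where

  open Language L

  data Term (n : ℕ) : Set ℓ where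
    var  : Fin n → Term n
    func : (f : Func) → Vec (Term n) (arityᶠ f) → Term n

  -- De Bruijn: in all' φ and ex' φ, index zero of φ is the bound variable.
  data Formula (n : ℕ) : Set ℓ where
    false'          : Formula n
    _≐'_            : Term n → Term n → Formula n
    rel             : (r : Rela) → Vec (Term n) (arityʳ r) → Formula n
    _⇒'_ _∧'_ _∨'_ : Formula n → Formula n → Formula n
    all' ex'        : Formula (suc n) → Formula n

  record Structure : Set (lsuc ℓ) where
    field
      Carrier  : Set ℓ
      nonempty : Carrier
      funcᴵ    : (f : Func) → Vec Carrier (arityᶠ f) → Carrier
      relᴵ     : (r : Rela) → Pred (Vec Carrier (arityʳ r)) ℓ

module _ {ℓ : Level} {L : Language ℓ} where

  not' : ∀ {n} → Formula L n → Formula L n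
  not' φ = φ ⇒' false'

  module _ (M : Structure L) where

    open Structure M

    eval  : ∀ {n} → Vec Carrier n → Term L n → Carrier
    evals : ∀ {n k} → Vec Carrier n → Vec (Term L n) k → Vec Carrier k
    eval v (var i)     = lookup v i
    eval v (func f ts) = funcᴵ f (evals v ts)
    evals v []         = []
    evals v (t ∷ ts)   = eval v t ∷ evals v ts

    Sat : ∀ {n} → Formula L n → Vec Carrier n → Set ℓ
    Sat false'     v = ⊥
    Sat (s ≐' t)   v = eval v s ≡ eval v t
    Sat (rel r ts) v = relᴵ r (evals v ts)
    Sat (φ ⇒' ψ)   v = Sat φ v → Sat ψ v
    Sat (φ ∧' ψ)   v = Sat φ v × Sat ψ v
    Sat (φ ∨' ψ)   v = Sat φ v ⊎ Sat ψ v
    Sat (all' φ)   v = ∀ x → Sat φ (x ∷ v)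
    Sat (ex' φ)    v = ∃[ x ] Sat φ (x ∷ v)

Sentence : ∀ {ℓ} → Language ℓ → Set ℓ
Sentence L = Formula L 0

Theory : ∀ {ℓ} → Language ℓ → Set (lsuc ℓ)
Theory {ℓ} L = Pred (Sentence L) ℓ

module _ {ℓ : Level} {L : Language ℓ} where

  IsModel : Theory L → Structure L → Set ℓ
  IsModel T M = ∀ {σ} → σ ∈ T → Sat M σ []

  infix 4 _⊨_
  _⊨_ : Theory L → Sentence L → Set (lsuc ℓ)
  T ⊨ σ = ∀ M → IsModel T M → Sat M σ []

  record IsComplete (T : Theory L) : Set (lsuc ℓ) where
    field
      consistent : ∃[ M ] IsModel T M
      decides    : ∀ σ → (T ⊨ σ) ⊎ (T ⊨ not' σ)

------------------------------------------------------------------------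
-- Types over small sets

module Types {ℓ : Level} {L : Language ℓ} (M : Structure L) (κ : Ord ℓ) where

  open Structure M

  record SmallSet : Set (lsuc ℓ) where
    field
      set   : Pred Carrier ℓ
      small : (HasCardinality< κ) set

  open SmallSet public

  -- The formula φ(x, b): an L-formula φ(x, y) with |x| = n, together with a
  -- tuple b of elements of M substituted for y.
  record ParamFormula (n : ℕ) : Set ℓ where
    constructor _⟨_⟩
    field
      {arity} : ℕ
      formula : Formula L (n + arity)
      params  : Vec Carrier arity

  open ParamFormula public

  notᴾ : ∀ {n} → ParamFormula n → ParamFormula n
  notᴾ (φ ⟨ b ⟩) = not' φ ⟨ b ⟩

  Over : ∀ {n} → Pred Carrier ℓ → Pred (ParamFormula n) ℓ
  Over A φ = All A (params φ)

  infix 4 _⊩_ _⊩*_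
  _⊩_ : ∀ {n} → Vec Carrier n → ParamFormula n → Set ℓ
  a ⊩ φ = Sat M (formula φ) (a ++ params φ)

  _⊩*_ : ∀ {n} → Vec Carrier n → Pred (ParamFormula n) ℓ → Set ℓ
  a ⊩* π = ∀ {φ} → φ ∈ π → a ⊩ φ

  -- S n A is the set of complete n-types over A: sets of formulas over A,
  -- consistent with the theory of M with names for its elements (that is,
  -- finitely satisfiable in M), and containing each formula over A or its
  -- negation.
  record S (n : ℕ) (A : SmallSet) : Set (lsuc ℓ) where
    field
      formulas            : Pred (ParamFormula n) ℓ
      overA               : formulas ⊆ Over (set A)
      finitelySatisfiable : ∀ {Φ : List (ParamFormula n)} → Allᴸ (_∈ formulas) Φ →
                            ∃[ a ] Allᴸ (a ⊩_) Φ
      complete            : ∀ {φ} → φ ∈ Over (set A) →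
                            (φ ∈ formulas) ⊎ (notᴾ φ ∈ formulas)

  open S public

  infix 4 _⊆ᵗ_
  _⊆ᵗ_ : ∀ {n A B} → S n A → S n B → Set ℓ
  p ⊆ᵗ q = formulas p ⊆ formulas q

  record Automorphism : Set ℓ where
    field
      bijection    : Carrier ↔ Carrier
    open Inverse bijection public using (to; from)
    field
      preservesFunc : ∀ f xs → to (funcᴵ f xs) ≡ funcᴵ f (map to xs)
      preservesRel  : ∀ r xs → (xs ∈ relᴵ r) ⇔ (map to xs ∈ relᴵ r)

  -- π ^ f = { φ(x, f(b)) | φ(x, b) ∈ π }, written via the inverse of f.
  infixl 8 _^_
  _^_ : ∀ {n} → Pred (ParamFormula n) ℓ → Automorphism → Pred (ParamFormula n) ℓ
  (π ^ f) (φ ⟨ c ⟩) = φ ⟨ map (Automorphism.from f) c ⟩ ∈ π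

  -- q = p ^ f. The set of formulas of a complete type determines its domain,
  -- so for p over A this forces q to be a type over f(A).
  IsConjugate : ∀ {n A B} → Automorphism → S n A → S n B → Set ℓ
  IsConjugate f p q = formulas q ≐ (formulas p ^ f)

  IsSaturated : Set (lsuc ℓ)
  IsSaturated = ∀ {n A} (p : S n A) → ∃[ a ] a ⊩* formulas p

  IsElementaryMap : (A : SmallSet) → (∃ (set A) → Carrier) → Set ℓ
  IsElementaryMap A g = ∀ {m} (φ : Formula L m) (as : Vec (∃ (set A)) m) →
    Sat M φ (map proj₁ as) ⇔ Sat M φ (map g as)

  IsStronglyHomogeneous : Set (lsuc ℓ)
  IsStronglyHomogeneous = ∀ {A} (g : ∃ (set A) → Carrier) → IsElementaryMap A g →
    Σ[ f ∈ Automorphism ] (∀ a → Automorphism.to f (proj₁ a) ≡ g a)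

-- 𝔠 is κ-saturated and strongly κ-homogeneous for some infinite cardinal
-- κ > |L| + ℵ₀; a set is small if its cardinality is less than κ.
record MonsterModel {ℓ} {L : Language ℓ} (T : Theory L) : Set (lsuc ℓ) where
  field
    𝔠                   : Structure L
    isModel             : IsModel T 𝔠
    κ                   : Ord ℓ
    isInfiniteCardinal  : IsInfiniteCardinal κ
    |L|<κ               : (HasCardinality< κ) {∃ (Formula L)} U
    saturated           : Types.IsSaturated 𝔠 κ
    stronglyHomogeneous : Types.IsStronglyHomogeneous 𝔠 κ

------------------------------------------------------------------------
-- Dividing, forking and ranks

module Monster {ℓ : Level} {L : Language ℓ} {T : Theory L} (𝕄 : MonsterModel T) where

  open MonsterModel 𝕄 public using (𝔠; κ)
  open Types 𝔠 κ public
  open Structure 𝔠 using (Carrier)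

  -- b ≡_A b′, that is, tp(b/A) = tp(b′/A).
  SameType : SmallSet → ∀ {m} → Rel (Vec Carrier m) ℓ
  SameType A b b′ = ∀ ψ → ψ ∈ Over (set A) → (b ⊩ ψ) ⇔ (b′ ⊩ ψ)

  -- {φᵢ | i < ω} is k-inconsistent. By saturation, a finite set of formulas
  -- is inconsistent iff it is not realised in 𝔠.
  Inconsistent : ∀ {n} → ℕ → (ℕ → ParamFormula n) → Set ℓ
  Inconsistent k φs = (ι : Fin k → ℕ) → Injective _≡_ _≡_ ι →
    ¬ (∃[ a ] (∀ j → a ⊩ φs (ι j)))

  FormulaDivides : ∀ {n} → ParamFormula n → SmallSet → Set ℓ
  FormulaDivides (φ ⟨ b ⟩) A =
    ∃[ k ] Σ[ bs ∈ (ℕ → Vec Carrier _) ]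
      (∀ i → SameType A (bs i) b) × Inconsistent k (λ i → φ ⟨ bs i ⟩)

  -- A set of formulas divides over A if it implies a formula (with arbitrary
  -- parameters) dividing over A, and forks over A if it implies a finite
  -- disjunction of such formulas. Implication is tested on realisations in 𝔠.
  Divides : ∀ {n} → Pred (ParamFormula n) ℓ → SmallSet → Set ℓ
  Divides π A = ∃[ φ ] FormulaDivides φ A × (∀ a → a ⊩* π → a ⊩ φ)

  Forks : ∀ {n} → Pred (ParamFormula n) ℓ → SmallSet → Set ℓ
  Forks π A = ∃[ Φ ] Allᴸ (λ φ → FormulaDivides φ A) Φ
                   × (∀ a → a ⊩* π → Anyᴸ (a ⊩_) Φ)

  record TypeClass (c : Level) : Set (lsuc (ℓ ⊔ c)) where
    field
      Member          : ∀ {n A} → Pred (S n A) c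
      closedExtension : ∀ {n A B} {p : S n A} {q : S n B} →
                        p ⊆ᵗ q → Member p → Member q
      closedConjugate : ∀ {n A B} {p : S n A} {q : S n B} f →
                        IsConjugate f p q → Member p → Member q

  module _ {c : Level} (𝔄 : TypeClass c) where

    open TypeClass 𝔄

    record Rank (o : Level) : Set (lsuc (ℓ ⊔ o) ⊔ c) where
      field
        rank        : ∀ {n A} (p : S n A) → Member p → Ord∞ {o}
        heredity    : ∀ {n A B} {p : S n A} {q : S n B} (mp : Member p) (mq : Member q) →
                      p ⊆ᵗ q → rank q mq ≤∞ rank p mp
        isomorphism : ∀ {n A B} {p : S n A} {q : S n B} (mp : Member p) (mq : Member q) f →
                      IsConjugate f p q → rank p mp ≈∞ rank q mq

      IsRanked : ∀ {n A} (p : S n A) → Member p → Set (lsuc o)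
      IsRanked p mp = rank p mp <∞ ⊤⁺

  module _ {c o : Level} {𝔄 : TypeClass c} (R : Rank 𝔄 o) where

    open TypeClass 𝔄
    open Rank R

    IsDividingRank : Set (lsuc (ℓ ⊔ o) ⊔ c)
    IsDividingRank = ∀ {n A B} (p : S n A) (q : S n B) (mp : Member p) (mq : Member q) →
      p ⊆ᵗ q → IsRanked p mp → Divides (formulas q) A → rank q mq <∞ rank p mp

    IsForkingRank : Set (lsuc (ℓ ⊔ o) ⊔ c)
    IsForkingRank = ∀ {n A B} (p : S n A) (q : S n B) (mp : Member p) (mq : Member q) →
      p ⊆ᵗ q → IsRanked p mp → Forks (formulas q) A → rank q mq <∞ rank p mp

    HasExtension : Set (lsuc (ℓ ⊔ o) ⊔ c)
    HasExtension = ∀ {n A} (p : S n A) (mp : Member p) → IsRanked p mp →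
      ∀ (B : SmallSet) → set A ⊆ set B →
      Σ[ q ∈ S n B ] Σ[ p⊆q ∈ p ⊆ᵗ q ]
        rank p mp ≈∞ rank q (closedExtension p⊆q mp)

{-# OPTIONS --safe #-}

-- Suppose q implies a disjunction of formulas dividing over A. By Extension, q
-- has an extension q′ of the same rank whose domain contains the parameters of
-- the disjunction. As a complete type, q′ contains one of the disjuncts, so q′
-- divides over A and R(q) = R(q′) < R(p).

module Submission where

open import Defs
open import Level using (Level)

open import Data.Empty.Polymorphic using (⊥-elim)
open import Data.List.Base using (List; []; _∷_)
open import Data.List.Membership.Propositional using (find)
open import Data.List.Relation.Unary.All as Allᴸ using ([]; _∷_) renaming (All to Allᴸ)
open import Data.List.Relation.Unary.Any using (here; there) renaming (Any to Anyᴸ)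
open import Data.Product using (Σ-syntax; ∃-syntax; _×_; _,_; proj₁; proj₂)
open import Data.Sum.Base using (inj₁; inj₂)
open import Data.Vec.Base using (Vec; []; _∷_)
open import Data.Vec.Relation.Unary.All as All using (All; []; _∷_)
open import Function.Base using (id; _∘_)
open import Function.Bundles using (Equivalence; mk⇔)
open import Relation.Binary.Morphism.Structures using (IsOrderIsomorphism)
open import Relation.Binary.PropositionalEquality using (_≡_; refl; trans; cong)
open import Relation.Binary.Structures using (IsStrictTotalOrder)
open import Relation.Nullary.Construct.Add.Supremum using (⊤⁺; [_])
open import Relation.Nullary.Decidable using (yes; no)
open import Relation.Nullary.Negation using (contradiction)
open import Relation.Unary using (Pred; _∈_; _⊆_; _∪_; ｛_｝)
import Relation.Binary.Construct.Add.Supremum.Equality as Equality⁺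
import Relation.Binary.Construct.Add.Supremum.NonStrict as NonStrict⁺
import Relation.Binary.Construct.Add.Supremum.Strict as Strict⁺

module _ {o : Level} where

  -- Extension preserves ranks only up to isomorphism of ordinals, so a strict inequality has to be
  -- carried along one. As `f` is onto, `g ∘ f` has the same image as `g`.
  ≈ᵒ-<ᵒ-trans : {α β γ : Ord o} → α ≈ᵒ β → β <ᵒ γ → α <ᵒ γ
  ≈ᵒ-<ᵒ-trans {γ = γ} (f , iso) (c , g , g-mono , image) =
    c , g ∘ f , g-mono ∘ mono , λ y → mk⇔ (to y) (from y)
    where
    open IsOrderIsomorphism iso using (mono; surjective)
    open Ord γ using (_<_)

    to : ∀ y → y < c → ∃[ x ] g (f x) ≡ y
    to y y<c with Equivalence.to (image y) y<c
    ... | z , gz≡y with surjective z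
    ...   | x , fx≡z = x , trans (cong g (fx≡z refl)) gz≡y

    from : ∀ y → ∃[ x ] g (f x) ≡ y → y < c
    from y (x , gfx≡y) = Equivalence.from (image y) (f x , gfx≡y)

  ≈∞-<∞-trans : {α β γ : Ord∞ {o}} → α ≈∞ β → β <∞ γ → α <∞ γ
  ≈∞-<∞-trans {[ α ]} {[ β ]} {[ γ ]} Equality⁺.[ α≈β ] Strict⁺.[ β<γ ] =
    Strict⁺.[ ≈ᵒ-<ᵒ-trans {α} {β} {γ} α≈β β<γ ]
  ≈∞-<∞-trans Equality⁺.[ _ ] Strict⁺.[ _ ]<⊤⁺ = Strict⁺.[ _ ]<⊤⁺

  ≤∞-<⊤-trans : {α β : Ord∞ {o}} → α ≤∞ β → β <∞ ⊤⁺ → α <∞ ⊤⁺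
  -- The other case of `≤∞` would make `β` equal to `⊤⁺`, which is not below itself.
  ≤∞-<⊤-trans NonStrict⁺.[ _ ] _ = Strict⁺.[ _ ]<⊤⁺

module _ {ℓ : Level} {κ : Ord ℓ} (κ-infinite : IsInfiniteCardinal κ) where

  open Ord κ
  open IsInfiniteCardinal κ-infinite
  open IsStrictTotalOrder isStrictTotalOrder using (_≟_; irrefl) renaming (trans to <-trans)

  -- Inserting a single point avoids cardinal arithmetic: the bound moves from `k` to a larger
  -- index, which exists because `κ` has no last element.
  HasCardinality<-insert : ∀ {a} {X : Set ℓ} {A : Pred X a} x →
    (HasCardinality< κ) A → (HasCardinality< κ) (A ∪ ｛ x ｝)
  HasCardinality<-insert {X = X} {A} x (k , f , cover) =
    proj₁ (noLast k) , f′ , cover′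
    where
    -- f is only used below k, so the index k is free for x.
    f′ : Carrier → X
    f′ j with j ≟ k
    ... | yes _ = x
    ... | no  _ = f j

    f′-new : f′ k ≡ x
    f′-new with k ≟ k
    ... | yes _   = refl
    ... | no  k≢k = contradiction refl k≢k

    f′-old : ∀ {j} → j < k → f′ j ≡ f j
    f′-old {j} j<k with j ≟ k
    ... | yes j≡k = contradiction j<k (irrefl j≡k)
    ... | no  _   = refl

    cover′ : ∀ {y} → y ∈ A ∪ ｛ x ｝ → ∃[ j ] (j < proj₁ (noLast k)) × (f′ j ≡ y)
    cover′ (inj₁ y∈A) with cover y∈A
    ... | j , j<k , fj≡y = j , <-trans j<k (proj₂ (noLast k)) , trans (f′-old j<k) fj≡y
    cover′ (inj₂ refl) = k , proj₂ (noLast k) , f′-new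

module _ {ℓ : Level} {L : Language ℓ} {T : Theory L} (𝕄 : MonsterModel T) where

  open Monster 𝕄
  open MonsterModel 𝕄 using (isInfiniteCardinal; saturated)
  open Structure 𝔠 using (Carrier)

  insert : Carrier → SmallSet → SmallSet
  insert x A = record
    { set   = set A ∪ ｛ x ｝
    ; small = HasCardinality<-insert isInfiniteCardinal x (small A)
    }

  adjoinTuple : ∀ A {m} (b : Vec Carrier m) →
    Σ[ C ∈ SmallSet ] (set A ⊆ set C) × All (set C) b
  adjoinTuple A []      = A , id , []
  adjoinTuple A (x ∷ b) with adjoinTuple A b
  ... | C , A⊆C , b∈C = insert x C , inj₁ ∘ A⊆C , inj₂ refl ∷ All.map inj₁ b∈C

  -- A complete type decides only formulas over its domain, while the disjuncts witnessing forking
  -- may have parameters outside it. There are finitely many of these, so the enlarged domain is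
  -- still small.
  adjoinParams : ∀ A {n} (Φ : List (ParamFormula n)) →
    Σ[ C ∈ SmallSet ] (set A ⊆ set C) × Allᴸ (_∈ Over (set C)) Φ
  adjoinParams A []      = A , id , []
  adjoinParams A (φ ∷ Φ) with adjoinParams A Φ
  ... | C , A⊆C , Φ-over with adjoinTuple C (params φ)
  ...   | D , C⊆D , φ-over = D , C⊆D ∘ A⊆C , φ-over ∷ Allᴸ.map (All.map C⊆D) Φ-over

  -- The disjunct that holds at `a` is decided by `q`; its negation cannot be in `q`, since `a`
  -- would satisfy that too.
  containsDisjunct : ∀ {n C} (q : S n C) {a} → a ⊩* formulas q →
    ∀ {Φ} → Allᴸ (_∈ Over (set C)) Φ → Anyᴸ (a ⊩_) Φ → Anyᴸ (_∈ formulas q) Φ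
  containsDisjunct q a⊩q (φ-over ∷ _) (here a⊩φ) with complete q φ-over
  ... | inj₁ φ∈q  = here φ∈q
  ... | inj₂ ¬φ∈q = ⊥-elim (a⊩q ¬φ∈q a⊩φ)
  containsDisjunct q a⊩q (_ ∷ Φ-over) (there a⊩Φ) =
    there (containsDisjunct q a⊩q Φ-over a⊩Φ)

  -- One realisation, given by saturation, selects a disjunct. Since that disjunct belongs to `q`,
  -- all realisations of `q` satisfy it.
  forks⇒divides : ∀ {n A C} (q : S n C) {Φ : List (ParamFormula n)} →
    Allᴸ (_∈ Over (set C)) Φ → Allᴸ (λ φ → FormulaDivides φ A) Φ →
    (∀ a → a ⊩* formulas q → Anyᴸ (a ⊩_) Φ) → Divides (formulas q) A
  forks⇒divides q Φ-over Φ-divides q-implies-Φ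
    with saturated q
  ... | a , a⊩q with find (containsDisjunct q a⊩q Φ-over (q-implies-Φ a a⊩q))
  ...   | φ , φ∈Φ , φ∈q = φ , Allᴸ.lookup Φ-divides φ∈Φ , λ a a⊩q → a⊩q φ∈q

proposition2p18 : ∀ {ℓ c o : Level} {L : Language ℓ} (T : Theory L) → IsComplete T →
    (𝕄 : MonsterModel T) → let open Monster 𝕄 in
    (𝔄 : TypeClass c) (R : Rank 𝔄 o) →
    IsDividingRank R → HasExtension R → IsForkingRank R
proposition2p18 T _ 𝕄 𝔄 R dividing extension {A = A} {B} p q mp mq p⊆q p-ranked
                (Φ , Φ-divides , q-implies-Φ)
  with adjoinParams 𝕄 B Φ
... | C , B⊆C , Φ-over
  -- Extension applies to ranked types only; `q` is ranked by heredity from `p`.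
  with extension q mq (≤∞-<⊤-trans (heredity mp mq p⊆q) p-ranked) C B⊆C
  where open Monster.Rank R using (heredity)
...   | q′ , q⊆q′ , q≈q′ =
  ≈∞-<∞-trans q≈q′
    -- The dividing is over `A`, the domain of `p`, so the rank drop is applied to the pair `p`,
    -- `q′` rather than `q`, `q′`.
    (dividing p q′ mp (closedExtension q⊆q′ mq) (q⊆q′ ∘ p⊆q) p-ranked
      (forks⇒divides 𝕄 {A = A} q′ Φ-over Φ-divides
        λ a a⊩q′ → q-implies-Φ a (a⊩q′ ∘ q⊆q′)))
  where open Monster.TypeClass 𝔄 using (closedExtension)
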